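{- Let $G=(V,E)$ be a DAG with $|V|=n$ whose maximum out-degree is at most $d_{out}$. Then there exists an $r^{(sin)}$-visit $\psi$ of $G$ such that $b_{r^{(sin)}}(\psi)\leq 4\left(\sqrt{2}+1\right)\sqrt{d_{out}\, n}$.
   Context: For a vertex $v$ of a finite DAG $G=(V,E)$, $\mathrm{pred}(v)=\{u : (u,v)\in E\}$ and $\mathrm{suc}(v)=\{u : (v,u)\in E\}$; the maximum out-degree is $\max_v|\mathrm{suc}(v)|$. A visit rule $r$ for $G$ assigns to each $v\in V$ a non-empty family $r(v)$ of subsets of $\mathrm{pred}(v)$, called enablers of $v$. An $r$-sequence is a sequence $\psi$ of distinct vertices such that for every $1\le i\le|\psi|$ the set of vertices of the prefix $\psi[1..i-1]$ contains some enabler $Q\in r(\psi[i])$. An $r$-visit is an $r$-sequence containing all $n$ vertices. The $r$-boundary of an $r$-sequence $\psi$ is $B_r(\psi)=\{v\in V\setminus\psi : \exists Q\neq\emptyset,\ Q\in r(v),\ Q\subseteq\psi\}$, and $b_r(\psi)=\max_{1\le i\le|\psi|}|B_r(\psi[1..i])|$. The singleton rule is $r^{(sin)}(v)=\{\{u\}: u\in\mathrm{pred}(v)\}$ if $\mathrm{pred}(v)\neq\emptyset$, and $r^{(sin)}(v)=\{\emptyset\}$ otherwise. -}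

module Defs where

open import Data.Nat using (ℕ; zero; suc; _+_; _*_; _∸_; _^_; _≤_; _⊔_)
open import Data.Bool using (Bool; true; false; T; not; _∧_; _∨_)
open import Data.Fin using (Fin; toℕ)
open import Data.Fin.Properties using (_≟_)
open import Data.Vec using (Vec; tabulate) renaming (lookup to vlookup)
open import Data.Fin.Subset using (Subset; ⁅_⁆; ∣_∣) renaming (⊥ to ∅ₛ; _∈_ to _∈ₛ_)
open import Data.List using (List; []; _∷_; map; filterᵇ; allFin; foldr; applyUpTo; take; length; lookup; null)
open import Data.Bool.ListAction using (any; all)
open import Data.List.Membership.Propositional using (_∈_)
open import Data.List.Relation.Unary.Any using (Any)
open import Data.List.Relation.Unary.Unique.Propositional using (Unique)
open import Data.Product using (_×_)
open import Relation.Nullary.Decidable using (⌊_⌋)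
open import Relation.Nullary using (¬_)

Graph : ℕ → Set
Graph n = Fin n → Fin n → Bool

data Path⁺ {n : ℕ} (E : Graph n) : Fin n → Fin n → Set where
  edge : ∀ {u v} → T (E u v) → Path⁺ E u v
  _∷ₚ_ : ∀ {u v w} → T (E u v) → Path⁺ E v w → Path⁺ E u w

IsDAG : ∀ {n} → Graph n → Set
IsDAG E = ∀ v → ¬ Path⁺ E v v

sucSet : ∀ {n} → Graph n → Fin n → Subset n
sucSet E v = tabulate (E v)

predList : ∀ {n} → Graph n → Fin n → List (Fin n)
predList E v = filterᵇ (λ u → E u v) (allFin _)

MaxOutDeg≤ : ∀ {n} → Graph n → ℕ → Set
MaxOutDeg≤ E d = ∀ v → ∣ sucSet E v ∣ ≤ d

-- A visit rule: for each vertex, its (finite, listed) family of enablers.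
Rule : ℕ → Set
Rule n = Fin n → List (Subset n)

rsin : ∀ {n} → Graph n → Rule n
rsin E v with null (predList E v)
... | true  = ∅ₛ ∷ []
... | false = map ⁅_⁆ (predList E v)

_⊆L_ : ∀ {n} → Subset n → List (Fin n) → Set
Q ⊆L xs = ∀ u → u ∈ₛ Q → u ∈ xs

IsRSeq : ∀ {n} → Rule n → List (Fin n) → Set
IsRSeq r ψ = Unique ψ × (∀ (i : Fin (length ψ)) → Any (λ Q → Q ⊆L take (toℕ i) ψ) (r (lookup ψ i)))

IsRVisit : ∀ {n} → Rule n → List (Fin n) → Set
IsRVisit r ψ = IsRSeq r ψ × (∀ v → v ∈ ψ)

memᵇ : ∀ {n} → Fin n → List (Fin n) → Bool
memᵇ v xs = any (λ u → ⌊ u ≟ v ⌋) xs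

nonemptyᵇ : ∀ {n} → Subset n → Bool
nonemptyᵇ Q = any (vlookup Q) (allFin _)

subsetᵇ : ∀ {n} → Subset n → List (Fin n) → Bool
subsetᵇ Q xs = all (λ u → not (vlookup Q u) ∨ memᵇ u xs) (allFin _)

boundary : ∀ {n} → Rule n → List (Fin n) → Subset n
boundary r ψ = tabulate (λ v → not (memᵇ v ψ) ∧ any (λ Q → nonemptyᵇ Q ∧ subsetᵇ Q ψ) (r v))

bval : ∀ {n} → Rule n → List (Fin n) → ℕ
bval r ψ = foldr _⊔_ 0 (applyUpTo (λ i → ∣ boundary r (take (suc i) ψ) ∣) (length ψ))

-- Exact integer encoding of  b ≤ 4(√2+1)√D  for b, D ∈ ℕ:
-- b ≤ 4(1+√2)√D  ⇔  b² ≤ 48D + 32√2·D  ⇔  (b² ∸ 48D)² ≤ 2048·D².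
Bound≤ : ℕ → ℕ → Set
Bound≤ b D = ((b * b) ∸ (48 * D)) ^ 2 ≤ 2048 * (D * D)

{-# OPTIONS --safe #-}
-- Explore a set Y of N vertices, all reachable from one root, by slabs of breadth-first
-- layers delimited by thin layers (at most θ ≈ √(dN/2) vertices).  The interior layers
-- of a slab are thick, so there are at most N/θ of them.  If some vertex of the slab
-- reaches more than N/2 vertices in it, pick a lowest such vertex M and visit a walk
-- from the first layer to M with at most one vertex per layer.  The rest of the slab
-- splits into single-root pieces of at most N/2 vertices: first those below M, then,
-- since more than N/2 vertices are gone, whatever is left.  While a piece is explored
-- recursively, the remaining boundary lies in the two thin layers and the children of
-- the walk, at most 2θ + dN/θ ≈ √(8dN) vertices, and b(N) ≤ b(N/2) + √(8dN) solves to
-- b(N) ≤ 4(√2 + 1)√(dN).  For N < 2d the trivial bound b(N) ≤ N suffices.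
module Submission where

open import Defs
open import Data.Bool using (Bool; true; false; T; not; _∧_)
open import Data.Bool.ListAction using (any)
open import Data.Bool.Properties using (T?; T-∧)
open import Data.Fin using (Fin; toℕ; fromℕ<) renaming (zero to fzero; suc to fsuc)
open import Data.Fin.Properties using (toℕ-fromℕ<) renaming (_≟_ to _≟F_)
open import Data.Fin.Subset using (⁅_⁆; ∣_∣) renaming (⊥ to ∅ₛ)
open import Data.Fin.Subset.Properties using (∉⊥; x∈⁅x⁆; x∈⁅y⁆⇒x≡y)
open import Data.List using (List; []; _∷_; _++_; _∷ʳ_; allFin; applyUpTo; drop; filter; filterᵇ; foldr; length; lookup; null; reverse; tabulate; take)
open import Data.List.Membership.Propositional using (_∈_; _∉_; find; lose)
open import Data.List.Membership.Propositional.Properties using (∈-++⁺ˡ; ∈-++⁺ʳ; ∈-++⁻; ∈-filter⁺; ∈-filter⁻; ∈-∃++; ∈-allFin)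
import Data.List.Membership.DecPropositional as DecMembership
open import Data.List.Properties using (length-++; length-tabulate; unfold-reverse; reverse-++; reverse-involutive; take++drop≡id; take-suc)
open import Data.List.Relation.Binary.Subset.Propositional using (_⊆_)
import Data.List.Relation.Unary.All as All
open import Data.List.Relation.Unary.All.Properties using (¬Any⇒All¬; all⁺)
open import Data.List.Relation.Unary.AllPairs using ([]; _∷_)
open import Data.List.Relation.Unary.Any using (Any; here; there; any?)
open import Data.List.Relation.Unary.Any.Properties using (any⁺; any⁻; map⁺; map⁻; reverse⁺; reverse⁻)
open import Data.List.Relation.Unary.Unique.Propositional using (Unique)
open import Data.List.Relation.Unary.Unique.Propositional.Properties using (allFin⁺; Unique[x∷xs]⇒x∉xs) renaming (filter⁺ to unique-filter; ++⁺ to unique-++)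
open import Data.Nat using (ℕ; zero; suc; _+_; _*_; _∸_; _^_; _⊔_; _≤_; _<_; z≤n; s≤s; _≤?_)
open import Data.Nat.Properties
open import Data.Nat.Tactic.RingSolver using (solve-∀)
open import Data.Product using (Σ; ∃; ∃₂; _×_; _,_; proj₁; proj₂)
open import Data.Sum using (_⊎_; inj₁; inj₂; [_,_]′; map₁; map₂)
open import Data.Unit using (⊤; tt)
import Data.Vec as Vec
open import Data.Vec.Properties using ([]=⇒lookup; lookup⇒[]=)
open import Function using (_∘_; id; Equivalence)
open import Relation.Binary.PropositionalEquality using (_≡_; _≢_; refl; sym; trans; cong; subst; module ≡-Reasoning)
open import Relation.Nullary using (¬_; ¬?; Dec; yes; no; contradiction)
open import Relation.Nullary.Decidable using (toWitness; fromWitness)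

-- Arithmetic of the integer-encoded bound

module _ where

  open ≤-Reasoning

  square-sum-≤ : ∀ p q → (p + q) * (p + q) ≤ 2 * (p * p + q * q)
  square-sum-≤ p q with ≤-total p q
  ... | inj₁ p≤q = subst (λ r → (p + r) * (p + r) ≤ 2 * (p * p + r * r)) (m+[n∸m]≡n p≤q)
                     (ordered p (q ∸ p))
    where
    ordered : ∀ p r → (p + (p + r)) * (p + (p + r)) ≤ 2 * (p * p + (p + r) * (p + r))
    ordered p r = m+n≤o⇒m≤o _ (≤-reflexive (identity p r))
      where
      identity : ∀ p r → (p + (p + r)) * (p + (p + r)) + r * r ≡ 2 * (p * p + (p + r) * (p + r))
      identity = solve-∀
  ... | inj₂ q≤p = subst (λ r → (r + q) * (r + q) ≤ 2 * (r * r + q * q)) (m+[n∸m]≡n q≤p)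
                     (ordered q (p ∸ q))
    where
    ordered : ∀ q r → (q + r + q) * (q + r + q) ≤ 2 * ((q + r) * (q + r) + q * q)
    ordered q r = m+n≤o⇒m≤o _ (≤-reflexive (identity q r))
      where
      identity : ∀ q r → (q + r + q) * (q + r + q) + r * r ≡ 2 * ((q + r) * (q + r) + q * q)
      identity = solve-∀

  floor-root-half : ∀ D → ∃ λ θ → 2 * (θ * θ) ≤ D × D < 2 * (suc θ * suc θ)
  floor-root-half zero = 0 , z≤n , s≤s z≤n
  floor-root-half (suc D) with floor-root-half D
  ... | θ , lower , upper with 2 * (suc θ * suc θ) ≤? suc D
  ...   | yes θ′-lower = suc θ , θ′-lower ,
            ≤-<-trans upper (*-monoʳ-< 2 (*-mono-< (n<1+n (suc θ)) (n<1+n (suc θ))))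
  ...   | no  θ′-upper = θ , m≤n⇒m≤1+n lower , ≰⇒> θ′-upper

  halve : ∀ n → ∃ λ h → h + h ≤ n × n ≤ suc (h + h)
  halve zero = 0 , z≤n , z≤n
  halve (suc zero) = 0 , z≤n , ≤-refl
  halve (suc (suc n)) with halve n
  ... | h , lower , upper = suc h
      , subst (_≤ suc (suc n)) (cong suc (sym (+-suc h h))) (s≤s (s≤s lower))
      , subst (suc (suc n) ≤_) (cong (λ k → suc (suc k)) (sym (+-suc h h))) (s≤s (s≤s upper))

  ^2≡* : ∀ m → m ^ 2 ≡ m * m
  ^2≡* m = cong (m *_) (*-identityʳ m)

  Bound≤-monoʳ : ∀ {b D D′} → D ≤ D′ → Bound≤ b D → Bound≤ b D′
  Bound≤-monoʳ {b} D≤D′ bound =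
    ≤-trans (^-monoˡ-≤ 2 (∸-monoʳ-≤ (b * b) (*-monoʳ-≤ 48 D≤D′)))
      (≤-trans bound (*-monoʳ-≤ 2048 (*-mono-≤ D≤D′ D≤D′)))

  Bound≤-monoˡ : ∀ {b b′ D} → b ≤ b′ → Bound≤ b′ D → Bound≤ b D
  Bound≤-monoˡ {D = D} b≤b′ bound =
    ≤-trans (^-monoˡ-≤ 2 (∸-monoˡ-≤ (48 * D) (*-mono-≤ b≤b′ b≤b′))) bound

  -- Truncated subtraction makes the left side of `Bound≤` vanish. This settles b = 0 and the
  -- trivial bound for N < 2d.
  Bound≤-square : ∀ {b D} → b * b ≤ 48 * D → Bound≤ b D
  Bound≤-square {b} {D} b²≤48D = ≤-trans (≤-reflexive (cong (_^ 2) (m≤n⇒m∸n≡0 b²≤48D))) z≤n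

  -- With α = 4(√2 + 1): α √(D/2) + √(8D) = α √D.
  Bound≤-halve : ∀ {D′ D} e k → 2 * D′ ≤ D → e * e ≤ 8 * D → Bound≤ k D′ → Bound≤ (e + k) D
  Bound≤-halve {D′} {D} e k 2D′≤D e²≤8D bound = begin
      ((e + k) * (e + k) ∸ 48 * D) ^ 2  ≤⟨ ^-monoˡ-≤ 2 (m≤n+o⇒m∸n≤o _ (48 * D) expand) ⟩
      (x + 2 * y) ^ 2                   ≡⟨ ^2≡* (x + 2 * y) ⟩
      (x + 2 * y) * (x + 2 * y)         ≤⟨ square-sum-≤ x (2 * y) ⟩
      2 * (x * x + (2 * y) * (2 * y))   ≡⟨ cong (λ z → 2 * (x * x + z)) (quadruple y) ⟩
      2 * (x * x + 4 * (y * y))         ≤⟨ *-monoʳ-≤ 2 (+-mono-≤ x²≤ (*-monoʳ-≤ 4 y²≤)) ⟩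
      2 * (512 * (D * D) + 4 * (128 * (D * D))) ≡⟨ constants (D * D) ⟩
      2048 * (D * D)                    ∎
    where
    -- `x` and `y` are the excesses over rational parts: k ≤ α√(D/2) and e ≤ √(8D) give k² ≤ (24 +
    -- 16√2)D and ek ≤ (8 + 8√2)D. Hence the targets x² ≤ 512D² and y² ≤ 128D². They bound x and 2y
    -- by the same value, so `square-sum-≤` loses nothing in the constant.
    x y : ℕ
    x = k * k ∸ 24 * D
    y = e * k ∸ 8 * D

    quadruple : ∀ y → (2 * y) * (2 * y) ≡ 4 * (y * y)
    quadruple = solve-∀

    constants : ∀ z → 2 * (512 * z + 4 * (128 * z)) ≡ 2048 * z
    constants = solve-∀

    k²≤ : k * k ≤ 24 * D + x
    k²≤ = m≤n+m∸n (k * k) (24 * D)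

    ek≤ : e * k ≤ 8 * D + y
    ek≤ = m≤n+m∸n (e * k) (8 * D)

    expand : (e + k) * (e + k) ≤ 48 * D + (x + 2 * y)
    expand = begin
      (e + k) * (e + k)                               ≡⟨ binomial e k ⟩
      e * e + 2 * (e * k) + k * k                     ≤⟨ +-mono-≤ (+-mono-≤ e²≤8D (*-monoʳ-≤ 2 ek≤)) k²≤ ⟩
      8 * D + 2 * (8 * D + y) + (24 * D + x)          ≡⟨ collect D x y ⟩
      48 * D + (x + 2 * y)                            ∎
      where
      binomial : ∀ e k → (e + k) * (e + k) ≡ e * e + 2 * (e * k) + k * k
      binomial = solve-∀
      collect : ∀ D x y → 8 * D + 2 * (8 * D + y) + (24 * D + x) ≡ 48 * D + (x + 2 * y)
      collect = solve-∀

    x²≤ : x * x ≤ 512 * (D * D)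
    x²≤ = begin
      x * x                             ≤⟨ *-mono-≤ x≤ x≤ ⟩
      (k * k ∸ 48 * D′) * (k * k ∸ 48 * D′) ≡⟨ ^2≡* (k * k ∸ 48 * D′) ⟨
      (k * k ∸ 48 * D′) ^ 2             ≤⟨ bound ⟩
      2048 * (D′ * D′)                  ≡⟨ rescale D′ ⟩
      512 * ((2 * D′) * (2 * D′))       ≤⟨ *-monoʳ-≤ 512 (*-mono-≤ 2D′≤D 2D′≤D) ⟩
      512 * (D * D)                     ∎
      where
      48D′≤ : 48 * D′ ≤ 24 * D
      48D′≤ = ≤-trans (≤-reflexive (double D′)) (*-monoʳ-≤ 24 2D′≤D)
        where
        double : ∀ z → 48 * z ≡ 24 * (2 * z)
        double = solve-∀
      x≤ : x ≤ k * k ∸ 48 * D′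
      x≤ = ∸-monoʳ-≤ (k * k) 48D′≤
      rescale : ∀ z → 2048 * (z * z) ≡ 512 * ((2 * z) * (2 * z))
      rescale = solve-∀

    y-equation : 8 * D ≤ e * k → y * y + 16 * D * y ≤ 128 * (D * D) + 8 * D * x
    y-equation 8D≤ek = +-cancelʳ-≤ (64 * (D * D)) _ _ (begin
      y * y + 16 * D * y + 64 * (D * D)       ≡⟨ complete-square D y ⟩
      (8 * D + y) * (8 * D + y)               ≡⟨ cong (λ z → z * z) (m+[n∸m]≡n 8D≤ek) ⟩
      (e * k) * (e * k)                       ≡⟨ swap e k ⟩
      (e * e) * (k * k)                       ≤⟨ *-mono-≤ e²≤8D k²≤ ⟩
      (8 * D) * (24 * D + x)                  ≡⟨ distribute D x ⟩
      128 * (D * D) + 8 * D * x + 64 * (D * D) ∎)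
      where
      complete-square : ∀ D y → y * y + 16 * D * y + 64 * (D * D) ≡ (8 * D + y) * (8 * D + y)
      complete-square = solve-∀
      swap : ∀ e k → (e * k) * (e * k) ≡ (e * e) * (k * k)
      swap = solve-∀
      distribute : ∀ D x → (8 * D) * (24 * D + x) ≡ 128 * (D * D) + 8 * D * x + 64 * (D * D)
      distribute = solve-∀

    y²≤ : y * y ≤ 128 * (D * D)
    -- If x ≤ 2y, the term 8Dx of `y-equation` is absorbed by 16Dy; otherwise 2y < x and the bound
    -- on x² suffices.
    y²≤ with 8 * D ≤? e * k | x ≤? 2 * y
    ... | no 8D≰ek | _ = subst (λ z → z * z ≤ 128 * (D * D)) (sym (m≤n⇒m∸n≡0 (<⇒≤ (≰⇒> 8D≰ek)))) z≤n
    ... | yes 8D≤ek | yes x≤2y = +-cancelʳ-≤ (16 * D * y) _ _ (begin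
      y * y + 16 * D * y                 ≤⟨ y-equation 8D≤ek ⟩
      128 * (D * D) + 8 * D * x          ≤⟨ +-monoʳ-≤ (128 * (D * D)) (*-monoʳ-≤ (8 * D) x≤2y) ⟩
      128 * (D * D) + 8 * D * (2 * y)    ≡⟨ cong (128 * (D * D) +_) (double D y) ⟩
      128 * (D * D) + 16 * D * y         ∎)
      where
      double : ∀ D y → 8 * D * (2 * y) ≡ 16 * D * y
      double = solve-∀
    ... | yes _ | no x≰2y = *-cancelˡ-≤ 4 (begin
      4 * (y * y)             ≡⟨ quadruple y ⟨
      (2 * y) * (2 * y)       ≤⟨ *-mono-≤ 2y≤x 2y≤x ⟩
      x * x                   ≤⟨ x²≤ ⟩
      512 * (D * D)           ≡⟨ *-assoc 4 128 (D * D) ⟩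
      4 * (128 * (D * D))     ∎)
      where
      2y≤x : 2 * y ≤ x
      2y≤x = <⇒≤ (≰⇒> x≰2y)

  -- Balances the thin-layer threshold θ ≈ √(dn/2) against q walk vertices of out-degree d.
  balanced-square : ∀ {n d θ q} → 2 * (θ * θ) ≤ d * n → d * n < 2 * (suc θ * suc θ) → q * suc θ ≤ n →
    (2 * θ + d * q) * (2 * θ + d * q) ≤ 8 * (d * n)
  balanced-square {n} {d} {θ} {q} lower upper qθ≤n = begin
      (2 * θ + z) * (2 * θ + z)              ≤⟨ square-sum-≤ (2 * θ) z ⟩
      2 * ((2 * θ) * (2 * θ) + z * z)        ≤⟨ *-monoʳ-≤ 2 (+-mono-≤ [2θ]²≤ z²≤) ⟩
      2 * (2 * D + 2 * D)                    ≡⟨ collect D ⟩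
      8 * D                                  ∎
    where
    D z : ℕ
    D = d * n
    z = d * q
    collect : ∀ D → 2 * (2 * D + 2 * D) ≡ 8 * D
    collect = solve-∀
    [2θ]²≤ : (2 * θ) * (2 * θ) ≤ 2 * D
    [2θ]²≤ = ≤-trans (≤-reflexive (regroup θ)) (*-monoʳ-≤ 2 lower)
      where
      regroup : ∀ θ → (2 * θ) * (2 * θ) ≡ 2 * (2 * (θ * θ))
      regroup = solve-∀
    zθ≤ : z * suc θ ≤ D
    zθ≤ = ≤-trans (≤-reflexive (*-assoc d q (suc θ))) (*-monoʳ-≤ d qθ≤n)
    -- Rounding θ down costs nothing: z ≤ D/(θ+1), and `upper` makes D²/(θ+1)² at most 2D.
    z²≤ : z * z ≤ 2 * D
    z²≤ = *-cancelʳ-≤ _ _ (suc θ * suc θ) (begin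
      z * z * (suc θ * suc θ)        ≡⟨ regroup z (suc θ) ⟩
      (z * suc θ) * (z * suc θ)      ≤⟨ *-mono-≤ zθ≤ zθ≤ ⟩
      D * D                          ≤⟨ *-monoʳ-≤ D (<⇒≤ upper) ⟩
      D * (2 * (suc θ * suc θ))      ≡⟨ shuffle D (suc θ) ⟩
      2 * D * (suc θ * suc θ)        ∎)
      where
      regroup : ∀ z t → z * z * (t * t) ≡ (z * t) * (z * t)
      regroup = solve-∀
      shuffle : ∀ D t → D * (2 * (t * t)) ≡ 2 * D * (t * t)
      shuffle = solve-∀

  frontier-square : ∀ {n d θ a b w e} → 2 * (θ * θ) ≤ d * n → d * n < 2 * (suc θ * suc θ) → 2 * d ≤ n →
    a ≤ θ → b ≤ θ → a + b + w * suc θ ≤ n → e ≤ a + b + d * suc w → e * e ≤ 8 * (d * n)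
  frontier-square {n} {d} {θ} {a} {b} {w} {e} lower upper 2d≤n a≤θ b≤θ total e≤ with a + b ≤? θ
  ... | yes a+b≤θ = ≤-trans (*-mono-≤ e≤′ e≤′)
                      (balanced-square {d = d} {q = w} lower upper (≤-trans (m≤n+m _ (a + b)) total))
    where
    d≤θ : d ≤ θ
    d≤θ with d ≤? θ
    ... | yes p = p
    ... | no  p = contradiction upper (≤⇒≯ (begin
      2 * (suc θ * suc θ)  ≤⟨ *-monoʳ-≤ 2 (*-mono-≤ (≰⇒> p) (≰⇒> p)) ⟩
      2 * (d * d)          ≡⟨ swap d ⟩
      d * (2 * d)          ≤⟨ *-monoʳ-≤ d 2d≤n ⟩
      d * n                ∎))
      where
      swap : ∀ d → 2 * (d * d) ≡ d * (2 * d)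
      swap = solve-∀
    e≤′ : e ≤ 2 * θ + d * w
    e≤′ = begin
      e                     ≤⟨ e≤ ⟩
      a + b + d * suc w     ≤⟨ +-monoˡ-≤ (d * suc w) a+b≤θ ⟩
      θ + d * suc w         ≡⟨ cong (θ +_) (*-suc d w) ⟩
      θ + (d + d * w)       ≤⟨ +-monoʳ-≤ θ (+-monoˡ-≤ (d * w) d≤θ) ⟩
      θ + (θ + d * w)       ≡⟨ collect θ (d * w) ⟩
      2 * θ + d * w         ∎
      where
      collect : ∀ t z → t + (t + z) ≡ 2 * t + z
      collect = solve-∀
  ... | no  a+b≰θ = ≤-trans (*-mono-≤ e≤′ e≤′)
                      (balanced-square {d = d} {q = suc w} lower upper
                        (≤-trans (+-monoˡ-≤ (w * suc θ) (≰⇒> a+b≰θ)) total))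
    where
    e≤′ : e ≤ 2 * θ + d * suc w
    e≤′ = ≤-trans e≤ (+-monoˡ-≤ (d * suc w)
            (≤-trans (+-mono-≤ a≤θ b≤θ) (≤-reflexive (cong (θ +_) (sym (+-identityʳ θ))))))

-- Duplicate-free lists as finite sets

module _ {A : Set} where

  unique-⊆⇒length≤ : {xs ys : List A} → Unique xs → xs ⊆ ys → length xs ≤ length ys
  unique-⊆⇒length≤ {[]} _ _ = z≤n
  unique-⊆⇒length≤ {x ∷ xs} {ys} x∷xs! x∷xs⊆ys with ∈-∃++ (x∷xs⊆ys (here refl)) | x∷xs!
  ... | ps , qs , refl | _ ∷ xs! = ≤-trans
        (s≤s (unique-⊆⇒length≤ xs! xs⊆ps++qs))
        (≤-reflexive (trans (cong suc (length-++ ps)) (trans (sym (+-suc (length ps) (length qs))) (sym (length-++ ps)))))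
    where
    xs⊆ps++qs : xs ⊆ ps ++ qs
    xs⊆ps++qs y∈xs with ∈-++⁻ ps (x∷xs⊆ys (there y∈xs))
    ... | inj₁ y∈ps = ∈-++⁺ˡ y∈ps
    ... | inj₂ (here refl) = contradiction y∈xs (Unique[x∷xs]⇒x∉xs x∷xs!)
    ... | inj₂ (there y∈qs) = ∈-++⁺ʳ ps y∈qs

  unique-∷ : ∀ {x : A} {xs} → x ∉ xs → Unique xs → Unique (x ∷ xs)
  unique-∷ x∉xs xs! = ¬Any⇒All¬ _ x∉xs ∷ xs!

  decide-all : ∀ {P Q : A → Set} (xs : List A) → (∀ {x} → x ∈ xs → P x ⊎ Q x) →
    (∃ λ x → x ∈ xs × P x) ⊎ (∀ {x} → x ∈ xs → Q x)
  decide-all [] _ = inj₂ λ ()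
  decide-all (x ∷ xs) test with test (here refl) | decide-all xs (test ∘ there)
  ... | inj₁ px | _ = inj₁ (x , here refl , px)
  ... | inj₂ _  | inj₁ (y , y∈xs , py) = inj₁ (y , there y∈xs , py)
  ... | inj₂ qx | inj₂ qxs = inj₂ λ { (here refl) → qx ; (there y∈xs) → qxs y∈xs }

nonempty : ∀ {A : Set} {x : A} {xs} → x ∈ xs → 0 < length xs
nonempty (here _) = s≤s z≤n
nonempty (there _) = s≤s z≤n

unique-reverse : ∀ {A : Set} {xs : List A} → Unique xs → Unique (reverse xs)
unique-reverse [] = []
unique-reverse {xs = x ∷ xs} x∷xs!@(_ ∷ xs!) = subst Unique (sym (unfold-reverse x xs))
  (unique-++ (unique-reverse xs!) (All.[] ∷ [])
    λ { (x∈ , here refl) → Unique[x∷xs]⇒x∉xs x∷xs! (reverse⁻ x∈) })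

module _ {n : ℕ} where

  open DecMembership (_≟F_ {n}) public using (_∈?_)

  infixl 6 _∖_

  abstract

    _∖_ : List (Fin n) → List (Fin n) → List (Fin n)
    xs ∖ ys = filter (λ x → ¬? (x ∈? ys)) xs

    ∈-∖⁺ : ∀ {xs ys v} → v ∈ xs → v ∉ ys → v ∈ xs ∖ ys
    ∈-∖⁺ {ys = ys} = ∈-filter⁺ (λ x → ¬? (x ∈? ys))

    ∈-∖⁻ : ∀ {xs ys v} → v ∈ xs ∖ ys → v ∈ xs × v ∉ ys
    ∈-∖⁻ {ys = ys} = ∈-filter⁻ (λ x → ¬? (x ∈? ys))

    unique-∖ : ∀ {xs} ys → Unique xs → Unique (xs ∖ ys)
    unique-∖ ys = unique-filter (λ x → ¬? (x ∈? ys))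

-- Walks, reach sets and lowest heavy vertices

module Walks {n : ℕ} (E : Graph n) where

  data Walk (X : List (Fin n)) : ℕ → Fin n → Fin n → Set where
    start : ∀ {x} → x ∈ X → Walk X 0 x x
    step  : ∀ {k x y z} → Walk X k x y → T (E y z) → z ∈ X → Walk X (suc k) x z

  Reachable : List (Fin n) → Fin n → Fin n → Set
  Reachable X x y = ∃ λ k → Walk X k x y

  target∈ : ∀ {X k x y} → Walk X k x y → y ∈ X
  target∈ (start x∈X) = x∈X
  target∈ (step _ _ z∈X) = z∈X

  walk-mono : ∀ {X X′ k x y} → X ⊆ X′ → Walk X k x y → Walk X′ k x y
  walk-mono X⊆X′ (start x∈X) = start (X⊆X′ x∈X)
  walk-mono X⊆X′ (step p e z∈X) = step (walk-mono X⊆X′ p) e (X⊆X′ z∈X)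

  walk-++ : ∀ {X j k x y z} → Walk X j x y → Walk X k y z → Reachable X x z
  walk-++ p (start _) = _ , p
  walk-++ p (step q e z∈X) with walk-++ p q
  ... | _ , r = _ , step r e z∈X

  snoc : ∀ {x y z} → Path⁺ E x y → T (E y z) → Path⁺ E x z
  snoc (edge e) e′ = e ∷ₚ edge e′
  snoc (e ∷ₚ p) e′ = e ∷ₚ snoc p e′

  extend : ∀ {X k x y z} → Path⁺ E x y → Walk X k y z → Path⁺ E x z
  extend p (start _) = p
  extend p (step q e _) = snoc (extend p q) e

  walk⇒path⁺ : ∀ {X k x y} → Walk X k x y → x ≢ y → Path⁺ E x y
  walk⇒path⁺ (start _) x≢x = contradiction refl x≢x
  walk⇒path⁺ {x = x} (step {y = y} p e _) x≢z with x ≟F y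
  ... | yes refl = edge e
  ... | no  x≢y  = snoc (walk⇒path⁺ p x≢y) e

  record ReachSet (X : List (Fin n)) (x : Fin n) : Set where
    field
      members : List (Fin n)
      unique  : Unique members
      root∈   : x ∈ members
      sound   : ∀ {y} → y ∈ members → Reachable X x y
      closed  : ∀ {u z} → u ∈ members → T (E u z) → z ∈ X → z ∈ members

    within : members ⊆ X
    within y∈ = target∈ (proj₂ (sound y∈))

    complete : ∀ {k y} → Walk X k x y → y ∈ members
    complete (start _) = root∈
    complete (step p e z∈X) = closed (complete p) e z∈X

    confine : ∀ {k y} → Walk X k x y → Walk members k x y
    confine (start _) = start root∈
    confine (step p e z∈X) = step (confine p) e (complete (step p e z∈X))

  open ReachSet

  -- Saturation: a vertex of X outside K with a predecessor in K is added until none is left. The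
  -- invariant |X| ≤ |K| + fuel rules out exhaustion, since at fuel 0 a further vertex would give
  -- more than |X| distinct vertices of X.
  reachSet : ∀ {X x} → x ∈ X → ReachSet X x
  reachSet {X} {x} x∈X = grow (length X) (x ∷ []) (m≤n+m (length X) 1) (All.[] ∷ [])
      (here refl) λ { (here refl) → 0 , start x∈X }
    where
    grow : ∀ fuel K → length X ≤ length K + fuel → Unique K → x ∈ K →
      (∀ {y} → y ∈ K → Reachable X x y) → ReachSet X x
    grow fuel K enough K! x∈K K-sound
      with any? (λ z → any? (λ u → T? (E u z)) K) (X ∖ K)
    ... | no none = record
        { members = K ; unique = K! ; root∈ = x∈K ; sound = K-sound
        ; closed = λ {u} {z} u∈K e z∈X → K-closed u∈K e z∈X }
      where
      K-closed : ∀ {u z} → u ∈ K → T (E u z) → z ∈ X → z ∈ K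
      K-closed {z = z} u∈K e z∈X with z ∈? K
      ... | yes z∈K = z∈K
      ... | no  z∉K = contradiction (lose (∈-∖⁺ z∈X z∉K) (lose u∈K e)) none
    ... | yes some with find some
    ...   | z , z∈X∖K , preds with find preds | ∈-∖⁻ z∈X∖K
    ...     | u , u∈K , e | z∈X , z∉K with fuel
    ...       | suc fuel = grow fuel (z ∷ K) (≤-trans enough (≤-reflexive (+-suc (length K) fuel)))
                    (unique-∷ z∉K K!) (there x∈K) zK-sound
      where
      zK-sound : ∀ {y} → y ∈ z ∷ K → Reachable X x y
      zK-sound (here refl) = _ , step (proj₂ (K-sound u∈K)) e z∈X
      zK-sound (there y∈K) = K-sound y∈K
    ...       | zero = contradiction (≤-trans enough (≤-reflexive (+-identityʳ _)))
                    (<⇒≱ (unique-⊆⇒length≤ (unique-∷ z∉K K!) zK⊆X))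
      where
      zK⊆X : z ∷ K ⊆ X
      zK⊆X (here refl) = z∈X
      zK⊆X (there y∈K) = target∈ (proj₂ (K-sound y∈K))

  -- Quantifying over all duplicate-free lists, instead of measuring one reach set, makes the
  -- passage to a subset of X a matter of `walk-mono` alone.
  Small : List (Fin n) → ℕ → Fin n → Set
  Small X h x = ∀ K → Unique K → (∀ {y} → y ∈ K → Reachable X x y) → length K ≤ h

  small-mono : ∀ {X X′ h x} → X′ ⊆ X → Small X h x → Small X′ h x
  small-mono X′⊆X small K K! sound′ =
    small K K! (λ y∈K → let k , p = sound′ y∈K in k , walk-mono X′⊆X p)

  heavy-or-small : ∀ {X x} h → x ∈ X → (Σ (ReachSet X x) λ K → h < length (members K)) ⊎ Small X h x
  heavy-or-small h x∈X with reachSet x∈X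
  ... | K with suc h ≤? length (members K)
  ...   | yes heavy = inj₁ (K , heavy)
  ...   | no  light = inj₂ λ K′ K′! sound′ →
            ≤-trans (unique-⊆⇒length≤ K′! λ y∈K′ → complete K (proj₂ (sound′ y∈K′))) (≮⇒≥ light)

  record MinimalHeavy (X : List (Fin n)) (h : ℕ) : Set where
    field
      apex    : Fin n
      reach   : ReachSet X apex
      heavy   : h < length (members reach)
      minimal : ∀ {y} → y ∈ members reach → y ≢ apex → Small X h y

  -- While some other vertex y of the reach set of x is heavy, move to y. By acyclicity x is not
  -- reachable from y, so the reach set shrinks strictly and its size serves as fuel.
  minimal-heavy : IsDAG E → ∀ {X x} h (K : ReachSet X x) → h < length (members K) → MinimalHeavy X h
  minimal-heavy dag {X} h K₀ heavy₀ = descend (length (members K₀)) K₀ ≤-refl heavy₀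
    where
    Heavier : Fin n → Fin n → Set
    Heavier x y = y ≢ x × Σ (ReachSet X y) λ K → h < length (members K)

    descend : ∀ fuel {x} (K : ReachSet X x) → length (members K) ≤ fuel → h < length (members K) →
      MinimalHeavy X h
    descend zero K enough heavy = contradiction (≤-trans heavy enough) λ ()
    descend (suc fuel) {x} K enough heavy
      with decide-all {P = Heavier x} {Q = λ y → y ≢ x → Small X h y} (members K) test
      where
      test : ∀ {y} → y ∈ members K → Heavier x y ⊎ (y ≢ x → Small X h y)
      test {y} y∈K with y ≟F x | heavy-or-small h (within K y∈K)
      ... | yes y≡x | _ = inj₂ λ y≢x → contradiction y≡x y≢x
      ... | no  y≢x | inj₁ heavy-y = inj₁ (y≢x , heavy-y)
      ... | no  _   | inj₂ small-y = inj₂ λ _ → small-y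
    ... | inj₂ light = record { apex = x ; reach = K ; heavy = heavy ; minimal = light }
    ... | inj₁ (y , y∈K , y≢x , K′ , heavy′) = descend fuel K′
            (≤-pred (≤-trans (unique-⊆⇒length≤ (unique-∷ x∉K′ (unique K′)) xK′⊆K) enough)) heavy′
      where
      x⇝y = proj₂ (sound K y∈K)
      x∉K′ : x ∉ members K′
      x∉K′ x∈K′ = dag x (extend (walk⇒path⁺ x⇝y (y≢x ∘ sym)) (proj₂ (sound K′ x∈K′)))
      xK′⊆K : x ∷ members K′ ⊆ members K
      xK′⊆K (here refl) = root∈ K
      xK′⊆K (there z∈K′) = complete K (proj₂ (walk-++ x⇝y (proj₂ (sound K′ z∈K′))))

-- Partial visits and their extension by pieces

module Traversals {n : ℕ} (E : Graph n) where

  open Walks E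
  open ReachSet

  -- `R` marks the vertices that may be visited with no predecessor visited: the root `w` inside a
  -- piece, the sources in the whole graph.
  Enabled : (Fin n → Set) → List (Fin n) → Fin n → Set
  Enabled R V v = R v ⊎ ∃ λ u → u ∈ V × T (E u v)

  enabled-mono : ∀ {R V V′ v} → V ⊆ V′ → Enabled R V v → Enabled R V′ v
  enabled-mono V⊆V′ = map₂ λ { (u , u∈V , e) → u , V⊆V′ u∈V , e }

  -- `F` is a cover of the boundary, not the boundary itself: it may contain visited or repeated
  -- vertices, so covers can be kept unchanged or concatenated as the visit proceeds.
  Frontier : (Y V F : List (Fin n)) → Set
  Frontier Y V F = ∀ {u y} → u ∈ V → T (E u y) → y ∈ Y → y ∈ V ⊎ y ∈ F

  Exits : (Y V X F : List (Fin n)) → Set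
  Exits Y V X F = ∀ {u y} → u ∈ X → T (E u y) → y ∈ Y → y ∈ V ⊎ y ∈ X ⊎ y ∈ F

  -- Visited vertices are listed latest first; Q constrains the size of a cover
  -- of the boundary inside Y after each visit.
  data Traversal (R : Fin n → Set) (Y : List (Fin n)) (Q : ℕ → Set) : List (Fin n) → Set where
    []    : Traversal R Y Q []
    visit : ∀ {v V F} → v ∉ V → Enabled R V v → Frontier Y (v ∷ V) F → Q (length F) →
            Traversal R Y Q V → Traversal R Y Q (v ∷ V)

  traversal-unique : ∀ {R Y Q V} → Traversal R Y Q V → Unique V
  traversal-unique [] = []
  traversal-unique (visit v∉V _ _ _ t) = unique-∷ v∉V (traversal-unique t)

  traversal-map : ∀ {R Y Q Q′ V} → (∀ {k} → Q k → Q′ k) → Traversal R Y Q V → Traversal R Y Q′ V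
  traversal-map f [] = []
  traversal-map f (visit v∉V en fr q t) = visit v∉V en fr (f q) (traversal-map f t)

  -- The list `Y` itself covers every boundary inside `Y`.
  traversal-trivial : ∀ {R Y Q Q′ V} → Q′ (length Y) → Traversal R Y Q V → Traversal R Y Q′ V
  traversal-trivial q [] = []
  traversal-trivial q (visit v∉V en _ _ t) =
    visit v∉V en (λ _ _ y∈Y → inj₂ y∈Y) q (traversal-trivial q t)

  record Exploration (Y : List (Fin n)) (w : Fin n) (Q : ℕ → Set) : Set where
    field
      visited   : List (Fin n)
      traversal : Traversal (_≡ w) Y Q visited
      inside    : visited ⊆ Y
      covers    : Y ⊆ visited

  Explorable : ℕ → (ℕ → Set) → Set
  Explorable h P = ∀ {K w} → Unique K → length K ≤ h → w ∈ K →
    (∀ {y} → y ∈ K → Reachable K w y) → Exploration K w P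

  record Extension (R : Fin n → Set) (Y : List (Fin n)) (Q : ℕ → Set) (V X : List (Fin n)) : Set where
    field
      visited   : List (Fin n)
      traversal : Traversal R Y Q visited
      old       : V ⊆ visited
      new       : X ⊆ visited
      only      : ∀ {v} → v ∈ visited → v ∈ V ⊎ v ∈ X

    frontier : ∀ {F} → Frontier Y V F → Exits Y V X F → Frontier Y visited F
    frontier fr ex u∈ e y∈Y with only u∈
    ... | inj₁ u∈V = map₁ old (fr u∈V e y∈Y)
    ... | inj₂ u∈X with ex u∈X e y∈Y
    ...   | inj₁ y∈V = inj₁ (old y∈V)
    ...   | inj₂ (inj₁ y∈X) = inj₁ (new y∈X)
    ...   | inj₂ (inj₂ y∈F) = inj₂ y∈F

  -- `F` covers what leaves V and K, while the piece's own cover F′ handles the edges inside K, so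
  -- `F ++ F′` covers the whole boundary. The root w, enabled by decree within the piece, is enabled
  -- by V here.
  append : ∀ {R Y P Q V F K w σ} → (∀ k → P k → Q (length F + k)) →
    Frontier Y V F → Exits Y V K F → (∀ {v} → v ∈ K → v ∉ V) → Enabled R V w →
    Traversal R Y Q V → Traversal (_≡ w) K P σ → σ ⊆ K → Traversal R Y Q (σ ++ V)
  append absorb fr ex K∩V en t [] σ⊆K = t
  append {R} {Y} {P} {Q} {V} {F} {K} {w} absorb fr ex K∩V en t (visit {v} {σ} {F′} v∉σ en-v fr′ p s) σ⊆K =
    visit v∉ (en′ en-v) fr″ (subst Q (sym (length-++ F)) (absorb _ p))
      (append absorb fr ex K∩V en t s (σ⊆K ∘ there))
    where
    v∉ : v ∉ σ ++ V
    v∉ v∈ with ∈-++⁻ σ v∈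
    ... | inj₁ v∈σ = v∉σ v∈σ
    ... | inj₂ v∈V = K∩V (σ⊆K (here refl)) v∈V
    en′ : Enabled (_≡ w) σ v → Enabled R (σ ++ V) v
    en′ (inj₁ refl) = enabled-mono {R} (∈-++⁺ʳ σ) en
    en′ (inj₂ (u , u∈σ , e)) = inj₂ (u , ∈-++⁺ˡ u∈σ , e)
    fr″ : Frontier Y (v ∷ σ ++ V) (F ++ F′)
    fr″ u∈ e y∈Y with ∈-++⁻ (v ∷ σ) u∈
    ... | inj₂ u∈V = [ inj₁ ∘ ∈-++⁺ʳ (v ∷ σ) , inj₂ ∘ ∈-++⁺ˡ ]′ (fr u∈V e y∈Y)
    ... | inj₁ u∈σ with ex (σ⊆K u∈σ) e y∈Y
    ...   | inj₁ y∈V = inj₁ (∈-++⁺ʳ (v ∷ σ) y∈V)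
    ...   | inj₂ (inj₂ y∈F) = inj₂ (∈-++⁺ˡ y∈F)
    ...   | inj₂ (inj₁ y∈K) = [ inj₁ ∘ ∈-++⁺ˡ , inj₂ ∘ ∈-++⁺ʳ F ]′ (fr′ u∈σ e y∈K)

  Rooted : (Fin n → Set) → (V Ω : List (Fin n)) → Fin n → Set
  Rooted R V Ω y = ∃ λ z → (z ∈ V ⊎ Enabled R V z) × Reachable Ω z y

  rooted-mono : ∀ {R V V′ Ω y} → V ⊆ V′ → Rooted R V Ω y → Rooted R V′ Ω y
  rooted-mono V⊆V′ (z , inj₁ z∈V , r) = z , inj₁ (V⊆V′ z∈V) , r
  rooted-mono {R} V⊆V′ (z , inj₂ en , r) = z , inj₂ (enabled-mono {R} V⊆V′ en) , r

  -- On a walk from a visited or enabled vertex, the first vertex in X is enabled: it is the root,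
  -- or its predecessor on the walk is in V.
  entry : ∀ {R V X Ω z k y} → (∀ {x} → x ∈ Ω → x ∈ V ⊎ x ∈ X) → z ∈ V ⊎ Enabled R V z →
    Walk Ω k z y → y ∈ V ⊎ ∃ λ x → x ∈ X × Enabled R V x
  entry Ω⊆ (inj₁ z∈V) (start _) = inj₁ z∈V
  entry Ω⊆ (inj₂ en) (start z∈Ω) with Ω⊆ z∈Ω
  ... | inj₁ z∈V = inj₁ z∈V
  ... | inj₂ z∈X = inj₂ (_ , z∈X , en)
  entry Ω⊆ root (step p e y∈Ω) with entry Ω⊆ root p | Ω⊆ y∈Ω
  ... | inj₂ found | _ = inj₂ found
  ... | inj₁ _ | inj₁ y∈V = inj₁ y∈V
  ... | inj₁ u∈V | inj₂ y∈X = inj₂ (_ , y∈X , inj₂ (_ , u∈V , e))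

  module _ {R : Fin n → Set} {Y : List (Fin n)} {P Q : ℕ → Set} {F : List (Fin n)} {h : ℕ}
           (chunks : Explorable h P) (absorb : ∀ k → P k → Q (length F + k)) where

    -- Some x in X is enabled; its reach set K in X is small, hence explorable. As K is closed in X,
    -- no edge leads from K to the rest of X, so once K is finished `F` alone is a cover again and
    -- the costs of successive pieces do not add up. `Ω` stays fixed while vertices move from X to
    -- V, so the walks witnessing `Rooted` remain valid.
    explore-pieces : ∀ fuel {V X Ω} → length X ≤ fuel → Traversal R Y Q V → Frontier Y V F →
      Exits Y V X F → Unique X → (∀ {v} → v ∈ X → v ∉ V) → (∀ {x} → x ∈ X → Small X h x) →
      (∀ {x} → x ∈ Ω → x ∈ V ⊎ x ∈ X) → (∀ {y} → y ∈ X → Rooted R V Ω y) → Extension R Y Q V X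
    explore-pieces _ {V} {[]} _ t _ _ _ _ _ _ _ =
      record { visited = V ; traversal = t ; old = id ; new = λ () ; only = inj₁ }
    explore-pieces (suc fuel) {V} {X@(x₀ ∷ _)} {Ω} enough t fr ex X! X∩V small Ω⊆ rooted
      with rooted (here refl)
    ... | _ , root , _ , walk with entry Ω⊆ root walk
    ...   | inj₁ x₀∈V = contradiction x₀∈V (X∩V (here refl))
    ...   | inj₂ (x , x∈X , en) = record
          { visited = visited rest
          ; traversal = traversal rest
          ; old = old rest ∘ old piece
          ; new = λ y∈X → new-X y∈X
          ; only = λ v∈ → only-X (only rest v∈)
          }
      where
      open Extension
      K : ReachSet X x
      K = reachSet x∈X
      expl : Exploration (members K) x P
      expl = chunks (unique K) (small x∈X (members K) (unique K) (sound K)) (root∈ K)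
               (λ y∈K → _ , confine K (proj₂ (sound K y∈K)))
      ex-K : Exits Y V (members K) F
      ex-K u∈K e y∈Y with ex (within K u∈K) e y∈Y
      ... | inj₁ y∈V = inj₁ y∈V
      ... | inj₂ (inj₁ y∈X) = inj₂ (inj₁ (closed K u∈K e y∈X))
      ... | inj₂ (inj₂ y∈F) = inj₂ (inj₂ y∈F)
      σ : List (Fin n)
      σ = Exploration.visited expl
      piece : Extension R Y Q V (members K)
      piece = record
        { visited = σ ++ V
        ; traversal = append absorb fr ex-K (X∩V ∘ within K) en t
            (Exploration.traversal expl) (Exploration.inside expl)
        ; old = ∈-++⁺ʳ σ
        ; new = ∈-++⁺ˡ ∘ Exploration.covers expl
        ; only = λ v∈ → [ inj₂ ∘ Exploration.inside expl , inj₁ ]′ (∈-++⁻ σ v∈)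
        }
      X′ : List (Fin n)
      X′ = X ∖ members K
      X′⊆X : X′ ⊆ X
      X′⊆X = proj₁ ∘ ∈-∖⁻
      split : ∀ {y} → y ∈ X → y ∈ visited piece ⊎ y ∈ X′
      split {y} y∈X with y ∈? members K
      ... | yes y∈K = inj₁ (new piece y∈K)
      ... | no  y∉K = inj₂ (∈-∖⁺ y∈X y∉K)
      x∷X′⊆X : x ∷ X′ ⊆ X
      x∷X′⊆X (here refl) = x∈X
      x∷X′⊆X (there y∈X′) = X′⊆X y∈X′
      shorter : length X′ < length X
      shorter = unique-⊆⇒length≤
        (unique-∷ (λ x∈X′ → proj₂ (∈-∖⁻ x∈X′) (root∈ K)) (unique-∖ (members K) X!)) x∷X′⊆X
      ex′ : Exits Y (visited piece) X′ F
      ex′ u∈X′ e y∈Y with ex (X′⊆X u∈X′) e y∈Y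
      ... | inj₁ y∈V = inj₁ (old piece y∈V)
      ... | inj₂ (inj₁ y∈X) = map₂ inj₁ (split y∈X)
      ... | inj₂ (inj₂ y∈F) = inj₂ (inj₂ y∈F)
      X′∩V : ∀ {v} → v ∈ X′ → v ∉ visited piece
      X′∩V v∈X′ v∈ with ∈-∖⁻ v∈X′ | only piece v∈
      ... | v∈X , _ | inj₁ v∈V = X∩V v∈X v∈V
      ... | _ , v∉K | inj₂ v∈K = v∉K v∈K
      rest : Extension R Y Q (visited piece) X′
      rest = explore-pieces fuel (≤-pred (≤-trans shorter enough)) (traversal piece)
        (frontier piece fr ex-K) ex′ (unique-∖ (members K) X!) X′∩V
        (λ y∈X′ → small-mono X′⊆X (small (X′⊆X y∈X′)))
        (λ y∈Ω → [ inj₁ ∘ old piece , split ]′ (Ω⊆ y∈Ω))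
        (λ y∈X′ → rooted-mono (old piece) (rooted (X′⊆X y∈X′)))
      new-X : X ⊆ visited rest
      new-X y∈X = [ old rest , new rest ]′ (split y∈X)
      only-X : ∀ {v} → v ∈ visited piece ⊎ v ∈ X′ → v ∈ V ⊎ v ∈ X
      only-X (inj₁ v∈) = map₂ (within K) (only piece v∈)
      only-X (inj₂ v∈X′) = inj₂ (X′⊆X v∈X′)

  -- Visiting the vertices of a walk

  children : Fin n → List (Fin n)
  children u = filter (λ v → T? (E u v)) (allFin n)

  ∈-children : ∀ {u v} → T (E u v) → v ∈ children u
  ∈-children e = ∈-filter⁺ (λ v → T? (E _ v)) (∈-allFin _) e

  module _ {R : Fin n → Set} {Y : List (Fin n)} {Q : ℕ → Set} {d : ℕ}
           (degree : ∀ u → length (children u) ≤ d) where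

    -- `wider` keeps F inside the new cover because the unvisited part of the slab still has its
    -- exits in F.
    record Trail (V F X : List (Fin n)) (b : ℕ) (v : Fin n) : Set where
      field
        visited   : List (Fin n)
        covering  : List (Fin n)
        traversal : Traversal R Y Q visited
        old       : V ⊆ visited
        end       : v ∈ visited
        only      : ∀ {v} → v ∈ visited → v ∈ V ⊎ v ∈ X
        wider     : F ⊆ covering
        frontier  : Frontier Y visited covering
        size      : length covering ≤ length F + b

    -- A new vertex enlarges the cover by its children; one visited earlier changes nothing. The
    -- case split takes care of walks that meet V or repeat a vertex.
    visit-one : ∀ {V F X v} → (∀ {e} → e ≤ length F + d → Q e) → Traversal R Y Q V → Frontier Y V F →
      v ∈ X → Enabled R V v → Trail V F X d v
    visit-one {V} {F} {X} {v} q t fr v∈X en with v ∈? V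
    ... | yes v∈V = record
        { visited = V ; covering = F ; traversal = t ; old = id ; end = v∈V ; only = inj₁
        ; wider = id ; frontier = fr ; size = m≤m+n _ _ }
    ... | no v∉V = record
        { visited = v ∷ V ; covering = children v ++ F
        ; traversal = visit v∉V en fr′ (q small) t
        ; old = there ; end = here refl
        ; only = λ { (here refl) → inj₂ v∈X ; (there u∈V) → inj₁ u∈V }
        ; wider = ∈-++⁺ʳ (children v) ; frontier = fr′ ; size = small }
      where
      small : length (children v ++ F) ≤ length F + d
      small = ≤-trans (≤-reflexive (trans (length-++ (children v)) (+-comm (length (children v)) _)))
                (+-monoʳ-≤ (length F) (degree v))
      fr′ : Frontier Y (v ∷ V) (children v ++ F)
      fr′ (here refl) e y∈Y = inj₂ (∈-++⁺ˡ (∈-children e))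
      fr′ (there u∈V) e y∈Y = [ inj₁ ∘ there , inj₂ ∘ ∈-++⁺ʳ (children v) ]′ (fr u∈V e y∈Y)

    -- The index k counts edges, so k + 1 vertices are visited, each adding at most d to the cover.
    follow : ∀ {V F X k s v} → (∀ {e} → e ≤ length F + d * suc k → Q e) → Traversal R Y Q V →
      Frontier Y V F → Enabled R V s → Walk X k s v → Trail V F X (d * suc k) v
    follow {V} {F} {X} {v = v} q t fr en (start s∈X) =
      subst (λ b → Trail V F X b v) (sym (*-identityʳ d))
        (visit-one (λ e≤ → q (≤-trans e≤ (≤-reflexive (cong (length F +_) (sym (*-identityʳ d)))))) t fr s∈X en)
    follow {V} {F} {X} {suc k} {s} {v} q t fr en (step p e v∈X) = record
        { visited = visited final ; covering = covering final ; traversal = traversal final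
        ; old = old final ∘ old first ; end = end final
        ; only = λ u∈ → [ only first , inj₂ ]′ (only final u∈)
        ; wider = wider final ∘ wider first ; frontier = frontier final
        ; size = total (size final) }
      where
      open Trail
      shorter : length F + d * suc k ≤ length F + d * suc (suc k)
      shorter = +-monoʳ-≤ (length F) (*-monoʳ-≤ d (n≤1+n (suc k)))
      first : Trail V F X (d * suc k) _
      first = follow (λ e≤ → q (≤-trans e≤ shorter)) t fr en p
      total : ∀ {e} → e ≤ length (covering first) + d → e ≤ length F + d * suc (suc k)
      total {e} e≤ = begin
        e                                 ≤⟨ e≤ ⟩
        length (covering first) + d       ≤⟨ +-monoˡ-≤ d (size first) ⟩
        length F + d * suc k + d          ≡⟨ +-assoc (length F) _ d ⟩
        length F + (d * suc k + d)        ≡⟨ cong (length F +_) (+-comm (d * suc k) d) ⟩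
        length F + (d + d * suc k)        ≡⟨ cong (length F +_) (*-suc d (suc k)) ⟨
        length F + d * suc (suc k)        ∎
        where open ≤-Reasoning
      final : Trail (visited first) (covering first) X d v
      final = visit-one (q ∘ total) (traversal first) (frontier first) v∈X
                (inj₂ (_ , end first , e))

-- Breadth-first slabs with thin borders

module Slabs {n : ℕ} (E : Graph n) where

  open Walks E
  open ReachSet
  open Traversals E

  -- Consecutive breadth-first layers X of Y ∖ V starting with S, up to but excluding the
  -- first later layer L with at most θ vertices; w counts the thick layers in between.
  record Slab (Y V S : List (Fin n)) (θ : ℕ) : Set where
    field
      X L      : List (Fin n)
      w        : ℕ
      X!       : Unique X
      S⊆X      : S ⊆ X
      X⊆Y      : X ⊆ Y
      X∩V      : ∀ {x} → x ∈ X → x ∉ V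
      walks    : ∀ {x} → x ∈ X → ∃₂ λ s k → s ∈ S × k ≤ w × Walk X k s x
      L!       : Unique L
      L⊆Y      : L ⊆ Y
      L∩V      : ∀ {x} → x ∈ L → x ∉ V
      L∩X      : ∀ {x} → x ∈ L → x ∉ X
      L-pred   : ∀ {y} → y ∈ L → ∃ λ u → u ∈ X × T (E u y)
      exits    : Exits Y V X L
      thin     : length L ≤ θ
      total    : length S + length L + w * suc θ ≤ length Y

  -- X absorbs the layer L of its fresh successors as long as L is thick. Each absorbed layer has at
  -- least θ + 1 vertices, which gives `total`, and it is nonempty even for θ = 0, which gives
  -- termination. A walk grows by one edge per layer, hence k ≤ w in `walks`.
  slab : ∀ {Y V S} θ → Unique S → S ⊆ Y → (∀ {x} → x ∈ S → x ∉ V) → Unique Y → Slab Y V S θ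
  slab {Y} {V} {S} θ S! S⊆Y S∩V Y! = grow (length Y) S 0 (m≤n+m (length Y) (length S)) S! id S⊆Y S∩V
      (λ s∈S → _ , 0 , s∈S , z≤n , start s∈S) (≤-reflexive (+-identityʳ (length S)))
    where
    grow : ∀ fuel X w → length Y ≤ length X + fuel → Unique X → S ⊆ X → X ⊆ Y → (∀ {x} → x ∈ X → x ∉ V) →
      (∀ {x} → x ∈ X → ∃₂ λ s k → s ∈ S × k ≤ w × Walk X k s x) →
      length S + w * suc θ ≤ length X → Slab Y V S θ
    grow fuel X w enough X! S⊆X X⊆Y X∩V walks size = finish (length L ≤? θ)
      where
      hit? : ∀ y → Dec (Any (λ u → T (E u y)) X)
      hit? y = any? (λ u → T? (E u y)) X

      L : List (Fin n)
      L = filter hit? (Y ∖ V ∖ X)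

      L! : Unique L
      L! = unique-filter hit? (unique-∖ X (unique-∖ V Y!))

      module _ {y : Fin n} (y∈L : y ∈ L) where
        L-fresh : y ∈ Y ∖ V ∖ X
        L-fresh = proj₁ (∈-filter⁻ hit? y∈L)
        L⊆Y : y ∈ Y
        L⊆Y = proj₁ (∈-∖⁻ (proj₁ (∈-∖⁻ L-fresh)))
        L∩V : y ∉ V
        L∩V = proj₂ (∈-∖⁻ (proj₁ (∈-∖⁻ L-fresh)))
        L∩X : y ∉ X
        L∩X = proj₂ (∈-∖⁻ L-fresh)
        L-pred : ∃ λ u → u ∈ X × T (E u y)
        L-pred = find (proj₂ (∈-filter⁻ hit? {xs = Y ∖ V ∖ X} y∈L))

      exits : Exits Y V X L
      exits {y = y} u∈X e y∈Y with y ∈? V | y ∈? X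
      ... | yes y∈V | _ = inj₁ y∈V
      ... | no _ | yes y∈X = inj₂ (inj₁ y∈X)
      ... | no y∉V | no y∉X =
        inj₂ (inj₂ (∈-filter⁺ hit? (∈-∖⁺ (∈-∖⁺ y∈Y y∉V) y∉X) (lose u∈X e)))

      LX! : Unique (L ++ X)
      LX! = unique-++ L! X! λ { (v∈L , v∈X) → L∩X v∈L v∈X }

      LX⊆Y : L ++ X ⊆ Y
      LX⊆Y v∈ = [ L⊆Y , X⊆Y ]′ (∈-++⁻ L v∈)

      LX≤Y : length L + length X ≤ length Y
      LX≤Y = subst (_≤ length Y) (length-++ L) (unique-⊆⇒length≤ LX! LX⊆Y)

      LX-walks : ∀ {x} → x ∈ L ++ X → ∃₂ λ s k → s ∈ S × k ≤ suc w × Walk (L ++ X) k s x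
      LX-walks x∈ with ∈-++⁻ L x∈
      ... | inj₂ x∈X = let s , k , s∈S , k≤w , p = walks x∈X in
            s , k , s∈S , m≤n⇒m≤1+n k≤w , walk-mono (∈-++⁺ʳ L) p
      ... | inj₁ x∈L = let u , u∈X , e = L-pred x∈L ; s , k , s∈S , k≤w , p = walks u∈X in
            s , suc k , s∈S , s≤s k≤w , step (walk-mono (∈-++⁺ʳ L) p) e x∈

      open ≤-Reasoning

      finish : Dec (length L ≤ θ) → Slab Y V S θ
      finish (yes thin) = record
        { X = X ; L = L ; w = w ; X! = X! ; S⊆X = S⊆X ; X⊆Y = X⊆Y ; X∩V = X∩V ; walks = walks
        ; L! = L! ; L⊆Y = L⊆Y ; L∩V = L∩V ; L∩X = L∩X ; L-pred = L-pred ; exits = exits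
        ; thin = thin
        ; total = begin
            length S + length L + w * suc θ   ≡⟨ cong (_+ w * suc θ) (+-comm (length S) (length L)) ⟩
            length L + length S + w * suc θ   ≡⟨ +-assoc (length L) _ _ ⟩
            length L + (length S + w * suc θ) ≤⟨ +-monoʳ-≤ (length L) size ⟩
            length L + length X               ≤⟨ LX≤Y ⟩
            length Y                          ∎ }
      finish (no thick) = continue fuel enough
        where
        continue : ∀ fuel → length Y ≤ length X + fuel → Slab Y V S θ
        continue zero enough = contradiction
          (≤-trans LX≤Y (≤-trans enough (≤-reflexive (+-identityʳ _))))
          (<⇒≱ (+-monoˡ-≤ (length X) (≤-trans (s≤s z≤n) (≰⇒> thick))))
        continue (suc fuel) enough = grow fuel (L ++ X) (suc w) enough′ LX! (∈-++⁺ʳ L ∘ S⊆X) LX⊆Y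
          (λ v∈ → [ L∩V , X∩V ]′ (∈-++⁻ L v∈)) LX-walks size′
          where
          enough′ : length Y ≤ length (L ++ X) + fuel
          enough′ = begin
            length Y                        ≤⟨ enough ⟩
            length X + suc fuel             ≡⟨ +-suc (length X) fuel ⟩
            suc (length X) + fuel           ≤⟨ +-monoˡ-≤ fuel (+-monoˡ-≤ (length X) (≤-trans (s≤s z≤n) (≰⇒> thick))) ⟩
            length L + length X + fuel      ≡⟨ cong (_+ fuel) (length-++ L) ⟨
            length (L ++ X) + fuel          ∎
          size′ : length S + suc w * suc θ ≤ length (L ++ X)
          size′ = begin
            length S + (suc θ + w * suc θ)  ≡⟨ +-assoc (length S) (suc θ) _ ⟨
            length S + suc θ + w * suc θ    ≡⟨ cong (_+ w * suc θ) (+-comm (length S) (suc θ)) ⟩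
            suc θ + length S + w * suc θ    ≡⟨ +-assoc (suc θ) (length S) _ ⟩
            suc θ + (length S + w * suc θ)  ≤⟨ +-mono-≤ (≰⇒> thick) size ⟩
            length L + length X             ≡⟨ length-++ L ⟨
            length (L ++ X)                 ∎

  -- Visiting one slab

  module _ (dag : IsDAG E) {d : ℕ} (degree : ∀ u → length (children u) ≤ d)
           {Y : List (Fin n)} {R : Fin n → Set} {P Q : ℕ → Set} {h θ : ℕ}
           (chunks : Explorable h P) (P0 : P 0) (half : length Y ≤ suc (h + h))
           (budget : ∀ {a b w e k} → a ≤ θ → b ≤ θ → a + b + w * suc θ ≤ length Y →
                     e ≤ a + b + d * suc w → P k → Q (e + k))
           where

    -- `S` covers the boundary of everything visited before and `L` the exits of the slab, so `F₀`
    -- accounts for every edge out of V or out of X. In `budget`, e measures this cover together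
    -- with the children of the walk, and k the cover inside the piece being explored.
    visit-slab : ∀ {V S} → Traversal R Y Q V → Frontier Y V S → (∀ {s} → s ∈ S → Enabled R V s) →
      length S ≤ θ → (B : Slab Y V S θ) → Extension R Y Q V (Slab.X B)
    visit-slab {V} {S} t fr en S-thin B = by-weight (decide-all X (heavy-or-small h))
      where
      open Slab B
      open Extension

      F₀ : List (Fin n)
      F₀ = S ++ L

      fr₀ : Frontier Y V F₀
      fr₀ u∈V e y∈Y = map₂ ∈-++⁺ˡ (fr u∈V e y∈Y)

      exits₀ : Exits Y V X F₀
      exits₀ u∈X e y∈Y = map₂ (map₂ (∈-++⁺ʳ S)) (exits u∈X e y∈Y)

      absorb : ∀ {e k} → e ≤ length F₀ + d * suc w → P k → Q (e + k)
      absorb e≤ = budget S-thin thin total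
        (≤-trans e≤ (≤-reflexive (cong (_+ d * suc w) (length-++ S))))

      rooted : ∀ {x V′} → V ⊆ V′ → x ∈ X → Rooted R V′ X x
      rooted V⊆V′ x∈X = let s , k , s∈S , _ , p = walks x∈X in
        s , inj₂ (enabled-mono {R} V⊆V′ (en s∈S)) , k , p

      by-weight : (∃ λ x → x ∈ X × Σ (ReachSet X x) λ K → h < length (members K)) ⊎
        (∀ {x} → x ∈ X → Small X h x) → Extension R Y Q V X
      by-weight (inj₂ small) = explore-pieces {F = F₀} chunks (λ k → absorb (m≤m+n _ _)) (length X)
        ≤-refl t fr₀ exits₀ X! X∩V small inj₂ (rooted id)
      by-weight (inj₁ (_ , _ , K₀ , heavy₀)) = around-apex (walks (within K (root∈ K)))
        where
        open MinimalHeavy (minimal-heavy dag h K₀ heavy₀) renaming (reach to K)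

        around-apex : (∃₂ λ s k → s ∈ S × k ≤ w × Walk X k s apex) → Extension R Y Q V X
        around-apex (s , k , s∈S , k≤w , p) = record
            { visited = visited above
            ; traversal = traversal above
            ; old = old above ∘ old below ∘ T.old
            ; new = λ {x} → new-X {x}
            ; only = λ v∈ → [ only-below ∘ only below , inj₂ ∘ proj₁ ∘ ∈-∖⁻ ]′ (only above v∈)
            }
          where
          walk-size : length F₀ + d * suc k ≤ length F₀ + d * suc w
          walk-size = +-monoʳ-≤ (length F₀) (*-monoʳ-≤ d (s≤s k≤w))

          trail : Trail degree V F₀ X (d * suc k) apex
          trail = follow degree
            -- No piece is open while the walk is visited, so the recursive share k is 0.
            (λ {e} e≤ → subst Q (+-identityʳ e) (absorb (≤-trans e≤ walk-size) P0)) t fr₀ (en s∈S) p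

          module T = Trail trail

          F : List (Fin n)
          F = T.covering

          absorbF : ∀ k → P k → Q (length F + k)
          absorbF _ = absorb (≤-trans T.size walk-size)

          A : List (Fin n)
          A = members K ∖ T.visited

          A⊆K : A ⊆ members K
          A⊆K = proj₁ ∘ ∈-∖⁻

          A⊆X : A ⊆ X
          A⊆X = within K ∘ A⊆K

          splitA : ∀ {y} → y ∈ members K → y ∈ T.visited ⊎ y ∈ A
          splitA {y} y∈K with y ∈? T.visited
          ... | yes y∈ = inj₁ y∈
          ... | no  y∉ = inj₂ (∈-∖⁺ y∈K y∉)

          -- `members K` is closed in X, so no edge leads from A to the part of the slab outside it.
          -- This is why the part below the apex comes first: the cover can leave out the rest.
          exitsA : Exits Y T.visited A F
          exitsA u∈A e y∈Y with exits₀ (A⊆X u∈A) e y∈Y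
          ... | inj₁ y∈V = inj₁ (T.old y∈V)
          ... | inj₂ (inj₁ y∈X) = map₂ inj₁ (splitA (closed K (A⊆K u∈A) e y∈X))
          ... | inj₂ (inj₂ y∈F) = inj₂ (inj₂ (T.wider y∈F))

          below : Extension R Y Q T.visited A
          below = explore-pieces {F = F} chunks absorbF (length A) ≤-refl T.traversal T.frontier exitsA
            (unique-∖ T.visited (unique K)) (proj₂ ∘ ∈-∖⁻)
            -- The apex is the only vertex of `members K` exempt from minimality, and the walk has
            -- already visited it.
            (λ x∈A → small-mono A⊆X (minimal (A⊆K x∈A) λ { refl → proj₂ (∈-∖⁻ x∈A) T.end }))
            splitA
            (λ y∈A → apex , inj₁ T.end , _ , confine K (proj₂ (sound K (A⊆K y∈A))))

          B′ : List (Fin n)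
          B′ = X ∖ visited below

          splitB : ∀ {y} → y ∈ X → y ∈ visited below ⊎ y ∈ B′
          splitB {y} y∈X with y ∈? visited below
          ... | yes y∈ = inj₁ y∈
          ... | no  y∉ = inj₂ (∈-∖⁺ y∈X y∉)

          exitsB : Exits Y (visited below) B′ F
          exitsB u∈B e y∈Y with exits₀ (proj₁ (∈-∖⁻ u∈B)) e y∈Y
          ... | inj₁ y∈V = inj₁ (old below (T.old y∈V))
          ... | inj₂ (inj₁ y∈X) = map₂ inj₁ (splitB y∈X)
          ... | inj₂ (inj₂ y∈F) = inj₂ (inj₂ (T.wider y∈F))

          -- By now all of `members K` is visited. It takes at least h + 1 of the at most 2h + 1
          -- vertices of Y, so at most h remain for C.
          smallB : ∀ {x} → x ∈ B′ → Small B′ h x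
          smallB _ C C! C-reach = +-cancelʳ-≤ (suc h) _ _ (begin
            length C + suc h                 ≤⟨ +-monoʳ-≤ (length C) heavy ⟩
            length C + length (members K)    ≡⟨ length-++ C ⟨
            length (C ++ members K)          ≤⟨ unique-⊆⇒length≤ (unique-++ C! (unique K) disjoint) CK⊆Y ⟩
            length Y                         ≤⟨ half ⟩
            suc (h + h)                      ≡⟨ +-suc h h ⟨
            h + suc h                        ∎)
            where
            open ≤-Reasoning
            C⊆B : ∀ {y} → y ∈ C → y ∈ B′
            C⊆B y∈C = target∈ (proj₂ (C-reach y∈C))
            disjoint : ∀ {y} → ¬ (y ∈ C × y ∈ members K)
            disjoint (y∈C , y∈K) = proj₂ (∈-∖⁻ (C⊆B y∈C)) ([ old below , new below ]′ (splitA y∈K))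
            CK⊆Y : C ++ members K ⊆ Y
            CK⊆Y y∈ = X⊆Y ([ proj₁ ∘ ∈-∖⁻ ∘ C⊆B , within K ]′ (∈-++⁻ C y∈))

          above : Extension R Y Q (visited below) B′
          above = explore-pieces {F = F} chunks absorbF (length B′) ≤-refl (traversal below)
            (frontier below T.frontier exitsA) exitsB (unique-∖ (visited below) X!) (proj₂ ∘ ∈-∖⁻)
            smallB splitB (λ y∈B → rooted (old below ∘ T.old) (proj₁ (∈-∖⁻ y∈B)))

          new-X : X ⊆ visited above
          new-X y∈X = [ old above , new above ]′ (splitB y∈X)

          only-below : ∀ {v} → v ∈ T.visited ⊎ v ∈ A → v ∈ V ⊎ v ∈ X
          only-below (inj₁ v∈) = T.only v∈
          only-below (inj₂ v∈A) = inj₂ (A⊆X v∈A)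

  -- Exploring a single-root set slab by slab

  module _ (dag : IsDAG E) {d : ℕ} (degree : ∀ u → length (children u) ≤ d)
           {Y : List (Fin n)} (Y! : Unique Y) {w : Fin n} (w∈Y : w ∈ Y)
           (reachable : ∀ {y} → y ∈ Y → Reachable Y w y) {P Q : ℕ → Set} {h θ : ℕ}
           (chunks : Explorable h P) (P0 : P 0) (half : length Y ≤ suc (h + h)) (1≤θ : 1 ≤ θ)
           (budget : ∀ {a b w e k} → a ≤ θ → b ≤ θ → a + b + w * suc θ ≤ length Y →
                     e ≤ a + b + d * suc w → P k → Q (e + k))
           where

    -- Between slabs, a thin unvisited layer S covers the boundary of V; the border L of one slab is
    -- the S of the next. At the start S is w alone, which is thin because 1 ≤ θ. Once S is empty, V
    -- contains w and is closed in Y, so it is all of Y.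
    explore-by-slabs : Exploration Y w Q
    explore-by-slabs = loop (length Y) (m≤n+m (length Y) 0) [] (λ ()) (λ ()) (All.[] ∷ [])
        (λ { (here refl) → w∈Y }) (λ _ ()) (λ { (here refl) → inj₁ refl }) 1≤θ (inj₂ (here refl))
      where
      loop : ∀ fuel {V S} → length Y ≤ length V + fuel → Traversal (_≡ w) Y Q V → V ⊆ Y →
        Frontier Y V S → Unique S → S ⊆ Y → (∀ {s} → s ∈ S → s ∉ V) →
        (∀ {s} → s ∈ S → Enabled (_≡ w) V s) → length S ≤ θ → w ∈ V ⊎ w ∈ S → Exploration Y w Q
      loop fuel {V} {[]} _ t V⊆Y fr _ _ _ _ _ w∈ = record
          { visited = V ; traversal = t ; inside = V⊆Y ; covers = λ y∈Y → closed-V (proj₂ (reachable y∈Y)) }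
        where
        shut : ∀ {y} → y ∈ V ⊎ y ∈ [] → y ∈ V
        shut (inj₁ y∈V) = y∈V
        closed-V : ∀ {k y} → Walk Y k w y → y ∈ V
        closed-V (start _) = shut w∈
        closed-V (step p e z∈Y) = shut (fr (closed-V p) e z∈Y)
      loop zero {V} {s ∷ _} enough t V⊆Y _ _ S⊆Y S∩V _ _ _ =
        contradiction (≤-trans enough (≤-reflexive (+-identityʳ _)))
          (<⇒≱ (unique-⊆⇒length≤ (unique-∷ (S∩V (here refl)) (traversal-unique t)) sV⊆Y))
        where
        sV⊆Y : s ∷ V ⊆ Y
        sV⊆Y (here refl) = S⊆Y (here refl)
        sV⊆Y (there v∈V) = V⊆Y v∈V
      loop (suc fuel) {V} {S@(s ∷ _)} enough t V⊆Y fr S! S⊆Y S∩V en S-thin w∈ =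
          loop fuel enough′ (traversal ext) V′⊆Y (λ {u} {y} → fr′ {u} {y}) L! L⊆Y L∩V′
            (λ y∈L → let u , u∈X , e = L-pred y∈L in inj₂ (u , new ext u∈X , e)) thin
            (inj₁ ([ old ext , new ext ∘ S⊆X ]′ w∈))
        where
        B : Slab Y V S θ
        B = slab θ S! S⊆Y S∩V Y!
        open Slab B hiding (w)
        ext : Extension (_≡ w) Y Q V X
        ext = visit-slab dag degree chunks P0 half budget t fr en S-thin B
        open Extension
        V′⊆Y : visited ext ⊆ Y
        V′⊆Y v∈ = [ V⊆Y , X⊆Y ]′ (only ext v∈)
        L∩V′ : ∀ {y} → y ∈ L → y ∉ visited ext
        L∩V′ y∈L y∈V′ = [ L∩V y∈L , L∩X y∈L ]′ (only ext y∈V′)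
        fr′ : Frontier Y (visited ext) L
        fr′ u∈ e y∈Y with only ext u∈
        ... | inj₁ u∈V = inj₁ ([ old ext , new ext ∘ S⊆X ]′ (fr u∈V e y∈Y))
        ... | inj₂ u∈X with exits u∈X e y∈Y
        ...   | inj₁ y∈V = inj₁ (old ext y∈V)
        ...   | inj₂ (inj₁ y∈X) = inj₁ (new ext y∈X)
        ...   | inj₂ (inj₂ y∈L) = inj₂ y∈L
        sV⊆V′ : s ∷ V ⊆ visited ext
        sV⊆V′ (here refl) = new ext (S⊆X (here refl))
        sV⊆V′ (there v∈V) = old ext v∈V
        longer : length V < length (visited ext)
        longer = unique-⊆⇒length≤ (unique-∷ (S∩V (here refl)) (traversal-unique t)) sV⊆V′
        enough′ : length Y ≤ length (visited ext) + fuel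
        enough′ = ≤-trans enough (≤-trans (≤-reflexive (+-suc (length V) fuel)) (+-monoˡ-≤ fuel longer))

  -- The halving recursion

  module _ (dag : IsDAG E) {d : ℕ} (1≤d : 1 ≤ d) (degree : ∀ u → length (children u) ≤ d) where

    explorable : ∀ fuel m → m ≤ fuel → Explorable m (λ b → Bound≤ b (d * m))
    explorable zero zero _ _ Y≤0 w∈Y _ = contradiction (nonempty w∈Y) (≤⇒≯ Y≤0)
    -- Both bounds on h are used: 2h ≤ N gives 2dh ≤ dN for `Bound≤-halve`, and N ≤ 2h + 1 makes
    -- what remains beside a heavy reach set small.
    explorable (suc fuel) m m≤fuel {Y} {w} Y! Y≤m w∈Y reachable with halve (length Y)
    ... | h , h+h≤Y , Y≤1+h+h = record
        { visited = visited ; inside = inside ; covers = covers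
        ; traversal = traversal-map (λ {b} → Bound≤-monoʳ {b} (*-monoʳ-≤ d Y≤m)) traversal }
      where
      N : ℕ
      N = length Y

      h≤fuel : h ≤ fuel
      h≤fuel = ≤-pred (≤-trans (h<Y h h+h≤Y) (≤-trans Y≤m m≤fuel))
        where
        h<Y : ∀ h → h + h ≤ N → h < N
        h<Y zero _ = nonempty w∈Y
        h<Y (suc h) h+h≤ = ≤-trans (s≤s (m≤n+m (suc h) h)) h+h≤

      chunks : Explorable h (λ b → Bound≤ b (d * h))
      chunks = explorable fuel h h≤fuel

      exploration : Exploration Y w (λ b → Bound≤ b (d * N))
      exploration with 2 * d ≤? N
      -- The slabs only supply an order here, with threshold 1 and the vacuous budget `⊤`; then Y
      -- itself is the cover, and N² ≤ 2dN is within 48dN.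
      ... | no 2d≰N = record
          { visited = Free.visited ; inside = Free.inside ; covers = Free.covers
          ; traversal = traversal-trivial (Bound≤-square {N} {d * N} square) Free.traversal }
        where
        module Free = Exploration (explore-by-slabs dag degree Y! w∈Y reachable {Q = λ _ → ⊤} chunks
          (Bound≤-square {0} {d * h} z≤n) Y≤1+h+h ≤-refl (λ _ _ _ _ _ → tt))
        square : N * N ≤ 48 * (d * N)
        square = begin
          N * N           ≤⟨ *-monoˡ-≤ N (<⇒≤ (≰⇒> 2d≰N)) ⟩
          2 * d * N       ≡⟨ *-assoc 2 d N ⟩
          2 * (d * N)     ≤⟨ *-monoˡ-≤ (d * N) (m≤m+n 2 46) ⟩
          48 * (d * N)    ∎
          where open ≤-Reasoning
      ... | yes 2d≤N with floor-root-half (d * N)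
      ...   | θ , lower , upper = explore-by-slabs dag degree Y! w∈Y reachable chunks
              (Bound≤-square {0} {d * h} z≤n) Y≤1+h+h (1≤θ θ upper)
              (λ {a} {b} {w} {e} {k} a≤θ b≤θ total e≤ → Bound≤-halve {d * h} {d * N} e k 2dh≤
                (frontier-square {d = d} {a = a} {b} {w} lower upper 2d≤N a≤θ b≤θ total e≤))
        where
        open ≤-Reasoning
        1≤θ : ∀ θ → d * N < 2 * (suc θ * suc θ) → 1 ≤ θ
        1≤θ (suc _) _ = s≤s z≤n
        1≤θ zero dN<2 = contradiction dN<2 (≤⇒≯ (begin
          2            ≤⟨ *-monoʳ-≤ 2 1≤d ⟩
          2 * d        ≤⟨ 2d≤N ⟩
          N            ≡⟨ *-identityˡ N ⟨
          1 * N        ≤⟨ *-monoˡ-≤ N 1≤d ⟩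
          d * N        ∎))
        2dh≤ : 2 * (d * h) ≤ d * N
        2dh≤ = begin
          2 * (d * h)      ≡⟨ cong (d * h +_) (+-identityʳ (d * h)) ⟩
          d * h + d * h    ≡⟨ *-distribˡ-+ d h h ⟨
          d * (h + h)      ≤⟨ *-monoʳ-≤ d h+h≤Y ⟩
          d * N            ∎

      open Exploration exploration

  -- From single-root sets to the whole graph

  Source : Fin n → Set
  Source v = ∀ u → ¬ T (E u v)

  module _ (dag : IsDAG E) where

    -- Climb along predecessors. By acyclicity the reach set of a predecessor u of v contains that
    -- of v and also u, so it grows strictly at each step and the climb ends.
    source-above : ∀ v → ∃ λ s → Source s × Reachable (allFin n) s v
    source-above v = climb (length (allFin n)) v (reachSet (∈-allFin v)) (m≤n+m _ _)
      where
      climb : ∀ fuel v (K : ReachSet (allFin n) v) → length (allFin n) ≤ length (members K) + fuel →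
        ∃ λ s → Source s × Reachable (allFin n) s v
      climb fuel v K enough with any? (λ u → T? (E u v)) (allFin n)
      ... | no none = v , (λ u e → none (lose (∈-allFin u) e)) , 0 , start (∈-allFin v)
      ... | yes some with find some
      ...   | u , _ , e = higher fuel enough
        where
        Kᵤ : ReachSet (allFin n) u
        Kᵤ = reachSet (∈-allFin u)
        u∉K : u ∉ members K
        u∉K u∈K = dag u (extend (edge e) (proj₂ (sound K u∈K)))
        u∷K⊆Kᵤ : u ∷ members K ⊆ members Kᵤ
        u∷K⊆Kᵤ (here refl) = root∈ Kᵤ
        u∷K⊆Kᵤ (there y∈K) = complete Kᵤ
          (proj₂ (walk-++ (step (start (∈-allFin u)) e (∈-allFin v)) (proj₂ (sound K y∈K))))
        larger : length (members K) < length (members Kᵤ)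
        larger = unique-⊆⇒length≤ (unique-∷ u∉K (unique K)) u∷K⊆Kᵤ
        higher : ∀ fuel → length (allFin n) ≤ length (members K) + fuel →
          ∃ λ s → Source s × Reachable (allFin n) s v
        higher zero enough = contradiction
          (unique-⊆⇒length≤ (unique Kᵤ) (λ _ → ∈-allFin _))
          (<⇒≱ (≤-trans (s≤s (≤-trans enough (≤-reflexive (+-identityʳ _)))) larger))
        higher (suc fuel) enough with climb fuel u Kᵤ
          (≤-trans enough (≤-trans (≤-reflexive (+-suc (length (members K)) fuel)) (+-monoˡ-≤ fuel larger)))
        ... | s , s-source , k , p = s , s-source , suc k , step p e (∈-allFin v)

    -- The full vertex set has no exits, so `F` is empty and `absorb` is the identity: every piece
    -- obeys the same bound, with nothing added to it.
    explore-graph : ∀ {d} → 1 ≤ d → (∀ u → length (children u) ≤ d) →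
      ∃ λ V → Traversal Source (allFin n) (λ b → Bound≤ b (d * n)) V × (∀ v → v ∈ V)
    explore-graph {d} 1≤d degree = visited , traversal , λ v → new (∈-allFin v)
      where
      extension : Extension Source (allFin n) (λ b → Bound≤ b (d * n)) [] (allFin n)
      extension = explore-pieces {R = Source} {Y = allFin n} {F = []}
        (explorable dag 1≤d degree n n ≤-refl) (λ _ → id) (length (allFin n)) {X = allFin n} {Ω = allFin n}
        ≤-refl [] (λ ()) (λ _ _ y∈ → inj₂ (inj₁ y∈)) (allFin⁺ n) (λ _ ())
        (λ _ K K! _ → ≤-trans (unique-⊆⇒length≤ K! (λ {y} _ → ∈-allFin y))
                        (≤-reflexive (length-tabulate id)))
        inj₂
        (λ {y} _ → let s , s-source , r = source-above y in s , inj₂ (inj₁ s-source) , r)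
      open Extension extension

-- Counting subsets, maxima and Boolean membership

length-filterᵇ-tabulate : ∀ {A : Set} {m} (f : A → Bool) (g : Fin m → A) →
  length (filterᵇ f (tabulate g)) ≡ ∣ Vec.tabulate (f ∘ g) ∣
length-filterᵇ-tabulate {m = zero} f g = refl
length-filterᵇ-tabulate {m = suc m} f g with f (g fzero)
... | true = cong suc (length-filterᵇ-tabulate f (g ∘ fsuc))
... | false = length-filterᵇ-tabulate f (g ∘ fsuc)

∣tabulate∣≤length : ∀ {m} (f : Fin m → Bool) {F} → (∀ {v} → T (f v) → v ∈ F) → ∣ Vec.tabulate f ∣ ≤ length F
∣tabulate∣≤length {m} f f⊆F = ≤-trans (≤-reflexive (sym (length-filterᵇ-tabulate f id)))
  (unique-⊆⇒length≤ (unique-filter (T? ∘ f) (allFin⁺ m))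
    λ v∈ → f⊆F (proj₂ (∈-filter⁻ (T? ∘ f) {xs = allFin m} v∈)))

max-applyUpTo : ∀ {Q : ℕ → Set} (f : ℕ → ℕ) m → Q 0 → (∀ {i} → i < m → Q (f i)) →
  Q (foldr _⊔_ 0 (applyUpTo f m))
max-applyUpTo f zero q0 q = q0
max-applyUpTo {Q} f (suc m) q0 q
  with ⊔-sel (f 0) (foldr _⊔_ 0 (applyUpTo (f ∘ suc) m))
... | inj₁ eq = subst Q (sym eq) (q (s≤s z≤n))
... | inj₂ eq = subst Q (sym eq) (max-applyUpTo {Q} (f ∘ suc) m q0 (q ∘ s≤s))

T-not⇒¬T : ∀ {b} → T (not b) → ¬ T b
T-not⇒¬T {false} _ ()

module _ {n : ℕ} where

  memᵇ⁺ : ∀ {v : Fin n} {xs} → v ∈ xs → T (memᵇ v xs)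
  memᵇ⁺ v∈xs = any⁺ _ (lose v∈xs (fromWitness refl))

  memᵇ⁻ : ∀ {v : Fin n} xs → T (memᵇ v xs) → v ∈ xs
  memᵇ⁻ xs t with find (any⁻ _ xs t)
  ... | u , u∈xs , u≡v with toWitness u≡v
  ...   | refl = u∈xs

  lookup-⁅⁆ : ∀ (u : Fin n) → Vec.lookup ⁅ u ⁆ u ≡ true
  lookup-⁅⁆ u = []=⇒lookup (x∈⁅x⁆ u)

  subsetᵇ-⁅⁆ : ∀ (u : Fin n) xs → T (subsetᵇ ⁅ u ⁆ xs) → u ∈ xs
  subsetᵇ-⁅⁆ u xs t with All.lookup (all⁺ _ (allFin n) t) (∈-allFin u)
  ... | t′ rewrite lookup-⁅⁆ u = memᵇ⁻ xs t′

  nonemptyᵇ-∅ : ¬ T (nonemptyᵇ (∅ₛ {n}))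
  nonemptyᵇ-∅ t with find (any⁻ (Vec.lookup (∅ₛ {n})) (allFin n) t)
  ... | u , _ , tᵤ with Vec.lookup (∅ₛ {n}) u in eq
  ...   | true = ∉⊥ (lookup⇒[]= u ∅ₛ eq)

-- From traversals to visits under the singleton rule

module SingletonRule {n : ℕ} (E : Graph n) where

  open Traversals E
  open Slabs E

  ∈-predList⁻ : ∀ {u v} → u ∈ predList E v → T (E u v)
  ∈-predList⁻ {v = v} u∈ = proj₂ (∈-filter⁻ (λ u → T? (E u v)) {xs = allFin n} u∈)

  ∈-predList⁺ : ∀ {u v} → T (E u v) → u ∈ predList E v
  ∈-predList⁺ {v = v} e = ∈-filter⁺ (λ u → T? (E u v)) (∈-allFin _) e

  enabled⇒rsin : ∀ {V v xs} → V ⊆ xs → Enabled Source V v → Any (_⊆L xs) (rsin E v)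
  enabled⇒rsin {v = v} V⊆xs en with predList E v in eq
  ... | [] = here λ _ u∈∅ → contradiction u∈∅ ∉⊥
  enabled⇒rsin {v = v} V⊆xs (inj₁ source) | u ∷ _ =
    contradiction (∈-predList⁻ (subst (u ∈_) (sym eq) (here refl))) (source u)
  enabled⇒rsin {v = v} V⊆xs (inj₂ (u , u∈V , e)) | _ ∷ _ =
    map⁺ (lose (∈-predList⁺ e) λ u′ u′∈ →
      subst (_∈ _) (sym (x∈⁅y⁆⇒x≡y u u′∈)) (V⊆xs u∈V))

  -- The empty enabler of a source fails `nonemptyᵇ`; every other enabler is a singleton, whose
  -- element gives the edge.
  enabler⇒edge : ∀ {v} xs → Any (λ Q → T (nonemptyᵇ Q ∧ subsetᵇ Q xs)) (rsin E v) →
    ∃ λ u → u ∈ xs × T (E u v)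
  enabler⇒edge {v} xs enabler with null (predList E v)
  enabler⇒edge {v} xs (here t) | true =
    contradiction (proj₁ (Equivalence.to (T-∧ {nonemptyᵇ {n} ∅ₛ}) t)) (nonemptyᵇ-∅ {n})
  ... | false with find (map⁻ enabler)
  ...   | u , u∈ , t = u , subsetᵇ-⁅⁆ u xs (proj₂ (Equivalence.to (T-∧ {nonemptyᵇ ⁅ u ⁆}) t)) , ∈-predList⁻ u∈

  boundary-≤ : ∀ {V F} xs → xs ⊆ V → V ⊆ xs → Frontier (allFin n) V F →
    ∣ boundary (rsin E) xs ∣ ≤ length F
  boundary-≤ {V} {F} xs xs⊆V V⊆xs fr = ∣tabulate∣≤length _ λ {v} → inside-F {v}
    where
    inside-F : ∀ {v} → T (not (memᵇ v xs) ∧ any (λ Q → nonemptyᵇ Q ∧ subsetᵇ Q xs) (rsin E v)) → v ∈ F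
    inside-F {v} t with Equivalence.to (T-∧ {not (memᵇ v xs)}) t
    ... | unvisited , enabler with enabler⇒edge xs (any⁻ _ (rsin E v) enabler)
    ...   | u , u∈xs , e with fr (xs⊆V u∈xs) e (∈-allFin v)
    ...     | inj₁ v∈V = contradiction (memᵇ⁺ (V⊆xs v∈V)) (T-not⇒¬T unvisited)
    ...     | inj₂ v∈F = v∈F

  suffix : ∀ {R Y Q V} us → Traversal R Y Q (us ++ V) → Traversal R Y Q V
  suffix [] t = t
  suffix (_ ∷ us) (visit _ _ _ _ t) = suffix us t

  -- Traversals list the latest vertex first, so the state after each visit is a tail of V.
  -- Rewriting that tail with `lookup` at its head lets a match on `visit` expose the data of step
  -- i.
  prefix-traversal : ∀ {R Y Q V} → Traversal R Y Q V → (i : Fin (length (reverse V))) →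
    Traversal R Y Q (lookup (reverse V) i ∷ reverse (take (toℕ i) (reverse V)))
  prefix-traversal {R} {Y} {Q} {V} t i = suffix (reverse (drop (suc (toℕ i)) ψ)) (subst (Traversal R Y Q) split t)
    where
    ψ : List (Fin n)
    ψ = reverse V
    open ≡-Reasoning
    split : V ≡ reverse (drop (suc (toℕ i)) ψ) ++ lookup ψ i ∷ reverse (take (toℕ i) ψ)
    split = begin
      V                                                          ≡⟨ reverse-involutive V ⟨
      reverse ψ                                                  ≡⟨ cong reverse (take++drop≡id (suc (toℕ i)) ψ) ⟨
      reverse (take (suc (toℕ i)) ψ ++ drop (suc (toℕ i)) ψ)     ≡⟨ reverse-++ (take (suc (toℕ i)) ψ) _ ⟩
      reverse (drop (suc (toℕ i)) ψ) ++ reverse (take (suc (toℕ i)) ψ)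
        ≡⟨ cong (λ xs → reverse (drop (suc (toℕ i)) ψ) ++ reverse xs) (take-suc ψ i) ⟩
      reverse (drop (suc (toℕ i)) ψ) ++ reverse (take (toℕ i) ψ ∷ʳ lookup ψ i)
        ≡⟨ cong (reverse (drop (suc (toℕ i)) ψ) ++_) (reverse-++ (take (toℕ i) ψ) (lookup ψ i ∷ [])) ⟩
      reverse (drop (suc (toℕ i)) ψ) ++ lookup ψ i ∷ reverse (take (toℕ i) ψ)   ∎

  traversal⇒visit : ∀ {Q V} → Traversal Source (allFin n) Q V → (∀ v → v ∈ V) → IsRVisit (rsin E) (reverse V)
  traversal⇒visit {Q} {V} t all∈V =
      (unique-reverse (traversal-unique t) , enabled) , λ v → reverse⁺ (all∈V v)
    where
    enabled : ∀ i → Any (_⊆L take (toℕ i) (reverse V)) (rsin E (lookup (reverse V) i))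
    enabled i with prefix-traversal t i
    ... | visit _ en _ _ _ = enabled⇒rsin reverse⁻ en

  -- A cover only bounds the boundary from above, so Q must pass to smaller numbers; `q0` answers
  -- for the initial value 0 of the maximum.
  traversal⇒bval : ∀ {Q V} → Q 0 → (∀ {a b} → a ≤ b → Q b → Q a) → Traversal Source (allFin n) Q V →
    Q (bval (rsin E) (reverse V))
  traversal⇒bval {Q} {V} q0 down t = max-applyUpTo {Q} _ (length ψ) q0 at
    where
    ψ : List (Fin n)
    ψ = reverse V
    at-index : ∀ i → Q ∣ boundary (rsin E) (take (suc (toℕ i)) ψ) ∣
    at-index i with prefix-traversal t i
    ... | visit _ _ fr q _ = down (boundary-≤ _ prefix⊆ ⊆prefix fr) q
      where
      reversed : reverse (take (suc (toℕ i)) ψ) ≡ lookup ψ i ∷ reverse (take (toℕ i) ψ)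
      reversed = trans (cong reverse (take-suc ψ i)) (reverse-++ (take (toℕ i) ψ) (lookup ψ i ∷ []))
      prefix⊆ : take (suc (toℕ i)) ψ ⊆ lookup ψ i ∷ reverse (take (toℕ i) ψ)
      prefix⊆ v∈ = subst (_ ∈_) reversed (reverse⁺ v∈)
      ⊆prefix : lookup ψ i ∷ reverse (take (toℕ i) ψ) ⊆ take (suc (toℕ i)) ψ
      ⊆prefix v∈ = reverse⁻ (subst (_ ∈_) (sym reversed) v∈)
    at : ∀ {i} → i < length ψ → Q ∣ boundary (rsin E) (take (suc i) ψ) ∣
    at i< = subst (λ j → Q ∣ boundary (rsin E) (take (suc j) ψ) ∣) (toℕ-fromℕ< i<) (at-index (fromℕ< i<))

  degree : ∀ {d} → MaxOutDeg≤ E d → ∀ u → length (children u) ≤ d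
  degree out u = ≤-trans (≤-reflexive (length-filterᵇ-tabulate (E u) id)) (out u)

theorem14 : (n : ℕ) (E : Graph n) (dout : ℕ) → IsDAG E → MaxOutDeg≤ E dout →
    Σ (List (Fin n)) (λ ψ → IsRVisit (rsin E) ψ × Bound≤ (bval (rsin E) ψ) (dout * n))
theorem14 n E (suc d) dag out = reverse V , traversal⇒visit t all∈V ,
    traversal⇒bval (Bound≤-square {0} {suc d * n} z≤n) (λ {a} {b} → Bound≤-monoˡ {a} {b} {suc d * n}) t
  where
  open SingletonRule E
  exploration = Slabs.explore-graph E dag (s≤s z≤n) (degree out)
  V = proj₁ exploration
  t = proj₁ (proj₂ exploration)
  all∈V = proj₂ (proj₂ exploration)
-- `explore-graph` asks for a positive degree bound, so the order comes from d = 1. As there are no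
-- edges, the empty list then covers every boundary.
theorem14 n E zero dag out = reverse V , traversal⇒visit t all∈V ,
    traversal⇒bval {Q = λ b → Bound≤ b 0} z≤n (λ {a} {b} → Bound≤-monoˡ {a} {b} {0}) (edgeless t)
  where
  open SingletonRule E
  open Traversals E
  exploration = Slabs.explore-graph E dag {1} (s≤s z≤n) (λ u → ≤-trans (degree out u) z≤n)
  V = proj₁ exploration
  t = proj₁ (proj₂ exploration)
  all∈V = proj₂ (proj₂ exploration)
  no-edge : ∀ {u v} → ¬ T (E u v)
  no-edge {u} e = contradiction (nonempty (∈-children e)) (≤⇒≯ (degree out u))
  edgeless : ∀ {R Y Q V} → Traversal R Y Q V → Traversal R Y (λ b → Bound≤ b 0) V
  edgeless [] = []
  edgeless (visit v∉V en _ _ t) = visit {F = []} v∉V en (λ _ e _ → contradiction e no-edge) z≤n (edgeless t)
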